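{- Let $G$ be a road network with a balanced tree hierarchy $H_G=(\mathcal{N},\mathcal{E},\ell)$. Let $L^*$ be a hierarchical cut 2-hop labelling of $G$ with respect to $H_G$ satisfying the cut cover property. Then the intersection of all hierarchical cut 2-hop labellings of $H_G$ is $L^*$; that is, for all $u,v\in V(G)$ with $\ell(u)\neq\ell(v)$, $u\in L^*(v)$ if and only if $u\in L(v)$ for all hierarchical cut 2-hop labellings $L$ of $H_G$.
   Context: A road network is a finite undirected graph $G=(V,E)$ in which each edge has a positive real weight; $d_G(s,t)$ is the minimum total weight of a path between $s$ and $t$. For $0<\beta\le 0.5$, a balanced tree hierarchy of $G$ is a rooted binary tree $H_G=(\mathcal{N},\mathcal{E},\ell)$ with node set $\mathcal{N}$, edge set $\mathcal{E}$ and a total surjective function $\ell:V(G)\to\mathcal{N}$ such that: (1) for every internal tree node $N_i$, $|\mathrm{Left}(N_i)|,|\mathrm{Right}(N_i)|\le(1-\beta)\cdot|\mathrm{Subtree}(N_i)|$, where $\mathrm{Left}(N_i)$, $\mathrm{Right}(N_i)$ are the sets of vertices mapped by $\ell$ into the left and right subtrees of $N_i$, and $\mathrm{Subtree}(N_i)$ is the set of vertices mapped into the whole subtree rooted at $N_i$ (including $N_i$); (2) for any $s,t\in V(G)$, $LCA(s,t)$ contains at least one vertex on a shortest path between $s$ and $t$. Here $LCA(s,t)$ is the lowest common ancestor of $\ell(s)$ and $\ell(t)$, and a tree node is identified with the set of vertices mapped to it by $\ell$; each tree node is thus regarded as a vertex cut $V_{cut}$ of the part of $G$ in its subtree. The vertex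 quasi-order $\preceq$ on $V(G)$: $v_i\preceq v_j$ iff $\ell(v_i)$ is an ancestor of $\ell(v_j)$ in $H_G$, a node counting as an ancestor of itself. A distance labelling $L$ assigns to each vertex $v$ a set $L(v)$ of distance entries $(u,\delta_{vu})$ with $u\in V(G)$ and $\delta_{vu}=d_G(v,u)$; write $u\in L(v)$ if $L(v)$ has an entry for $u$. It is a hierarchical cut 2-hop labelling with respect to $H_G$ (of $H_G$) if (i) $u\preceq v$ for every $v$ and every $u\in L(v)$; and (ii) for any two vertices $s,t\in V$ there exists $r\in LCA(s,t)$ with $(r,\delta_{sr})\in L(s)$, $(r,\delta_{tr})\in L(t)$ and $\delta_{sr}+\delta_{tr}=d_G(s,t)$. Cut cover property: for every tree node with vertex set $V_{cut}$, every vertex $v\notin V_{cut}$ in the subtree of that node, and every cut vertex $u\in V_{cut}$, one has $u\in L(v)$ if and only if there is no other cut vertex $u'\in V_{cut}$, $u'\ne u$, with $d_G(u,v)=d_G(u,u')+d_G(u',v)$. Distances between two vertices of the same cut (tree node) are assumed known separately, so entries for pairs $u,v$ with $\ell(u)=\ell(v)$ are not part of the comparison of labellings. -}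

module Defs where

open import Algebra.Bundles using (CommutativeRing)
open import Data.Fin using (Fin)
open import Data.List using (List; []; _∷_; length; filter; allFin)
open import Data.List.Membership.Propositional using (_∈_)
open import Data.List.Relation.Unary.Unique.Propositional using (Unique)
open import Data.Maybe using (Maybe; just)
open import Data.Nat using (ℕ; zero; suc)
open import Data.Product using (∃-syntax; Σ-syntax; _×_; _,_)
open import Data.Sum using (_⊎_)
open import Function.Bundles using (_⇔_)
open import Function.Definitions using (Surjective)
open import Level using (_⊔_; 0ℓ) renaming (suc to lsuc)
open import Relation.Binary using (Rel; IsTotalOrder; Decidable; Symmetric)
open import Relation.Binary.PropositionalEquality using (_≡_; _≢_)
open import Relation.Nullary using (¬_; yes; no)
open import Relation.Nullary.Decidable using (map′)
import Relation.Unary as U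

-- agda-stdlib has no real numbers, so weights and the balance parameter are
-- taken from an arbitrary totally ordered field; ℝ is (classically) one.
record OrderedField c ℓ₁ ℓ₂ : Set (lsuc (c ⊔ ℓ₁ ⊔ ℓ₂)) where
  infix 4 _≤_ _<_
  field
    commutativeRing : CommutativeRing c ℓ₁
  open CommutativeRing commutativeRing public
  field
    _≤_          : Rel Carrier ℓ₂
    isTotalOrder : IsTotalOrder _≈_ _≤_
    0≉1          : ¬ (0# ≈ 1#)
    inverse      : ∀ x → ¬ (x ≈ 0#) → ∃[ y ] x * y ≈ 1#
    +-monoˡ-≤    : ∀ {x y} z → x ≤ y → x + z ≤ y + z
    *-nonNeg     : ∀ {x y} → 0# ≤ x → 0# ≤ y → 0# ≤ x * y

  _<_ : Rel Carrier (ℓ₁ ⊔ ℓ₂)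
  x < y = x ≤ y × ¬ (x ≈ y)

  fromℕ : ℕ → Carrier
  fromℕ zero    = 0#
  fromℕ (suc n) = 1# + fromℕ n

card : ∀ {n p} {P : U.Pred (Fin n) p} → U.Decidable P → ℕ
card {n} P? = length (filter P? (allFin n))

-- A nonempty rooted binary tree; either child of a node may be absent.
data BinaryTree : Set where
  node : (left right : Maybe BinaryTree) → BinaryTree

data Node : BinaryTree → Set where
  root : ∀ {l r} → Node (node l r)
  inˡ  : ∀ {l r} → Node l → Node (node (just l) r)
  inʳ  : ∀ {l r} → Node r → Node (node l (just r))

-- N ⊑ M : N is an ancestor of M, or N is M.
infix 4 _⊑_
data _⊑_ : ∀ {t} → Node t → Node t → Set where
  root : ∀ {l r} {M : Node (node l r)} → root ⊑ M
  inˡ  : ∀ {l r} {N M : Node l} → N ⊑ M → inˡ {l} {r} N ⊑ inˡ M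
  inʳ  : ∀ {l r} {N M : Node r} → N ⊑ M → inʳ {l} {r} N ⊑ inʳ M

-- M lies in the subtree rooted at the left (right) child of N.
data InLeft : ∀ {t} → Node t → Node t → Set where
  root : ∀ {l r} {M : Node l} → InLeft (root {just l} {r}) (inˡ M)
  inˡ  : ∀ {l r} {N M : Node l} → InLeft N M → InLeft (inˡ {l} {r} N) (inˡ M)
  inʳ  : ∀ {l r} {N M : Node r} → InLeft N M → InLeft (inʳ {l} {r} N) (inʳ M)

data InRight : ∀ {t} → Node t → Node t → Set where
  root : ∀ {l r} {M : Node r} → InRight (root {l} {just r}) (inʳ M)
  inˡ  : ∀ {l r} {N M : Node l} → InRight N M → InRight (inˡ {l} {r} N) (inˡ M)
  inʳ  : ∀ {l r} {N M : Node r} → InRight N M → InRight (inʳ {l} {r} N) (inʳ M)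

Internal : ∀ {t} → Node t → Set
Internal N = ∃[ M ] (InLeft N M ⊎ InRight N M)

_⊑?_ : ∀ {t} → Decidable (_⊑_ {t})
root  ⊑? M     = yes root
inˡ N ⊑? root  = no λ ()
inˡ N ⊑? inˡ M = map′ inˡ (λ { (inˡ p) → p }) (N ⊑? M)
inˡ N ⊑? inʳ M = no λ ()
inʳ N ⊑? root  = no λ ()
inʳ N ⊑? inˡ M = no λ ()
inʳ N ⊑? inʳ M = map′ inʳ (λ { (inʳ p) → p }) (N ⊑? M)

inLeft? : ∀ {t} → Decidable (InLeft {t})
inLeft? root    root    = no λ ()
inLeft? root    (inˡ M) = yes root
inLeft? root    (inʳ M) = no λ ()
inLeft? (inˡ N) root    = no λ ()
inLeft? (inˡ N) (inˡ M) = map′ inˡ (λ { (inˡ p) → p }) (inLeft? N M)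
inLeft? (inˡ N) (inʳ M) = no λ ()
inLeft? (inʳ N) root    = no λ ()
inLeft? (inʳ N) (inˡ M) = no λ ()
inLeft? (inʳ N) (inʳ M) = map′ inʳ (λ { (inʳ p) → p }) (inLeft? N M)

inRight? : ∀ {t} → Decidable (InRight {t})
inRight? root    root    = no λ ()
inRight? root    (inˡ M) = no λ ()
inRight? root    (inʳ M) = yes root
inRight? (inˡ N) root    = no λ ()
inRight? (inˡ N) (inˡ M) = map′ inˡ (λ { (inˡ p) → p }) (inRight? N M)
inRight? (inˡ N) (inʳ M) = no λ ()
inRight? (inʳ N) root    = no λ ()
inRight? (inʳ N) (inˡ M) = no λ ()
inRight? (inʳ N) (inʳ M) = map′ inʳ (λ { (inʳ p) → p }) (inRight? N M)

lca : ∀ {t} → Node t → Node t → Node t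
lca (inˡ N) (inˡ M) = inˡ (lca N M)
lca (inʳ N) (inʳ M) = inʳ (lca N M)
lca root    _       = root
lca (inˡ _) root    = root
lca (inˡ _) (inʳ _) = root
lca (inʳ _) root    = root
lca (inʳ _) (inˡ _) = root

lca-⊑ˡ : ∀ {t} (N M : Node t) → lca N M ⊑ N
lca-⊑ˡ (inˡ N) (inˡ M) = inˡ (lca-⊑ˡ N M)
lca-⊑ˡ (inʳ N) (inʳ M) = inʳ (lca-⊑ˡ N M)
lca-⊑ˡ root    _       = root
lca-⊑ˡ (inˡ _) root    = root
lca-⊑ˡ (inˡ _) (inʳ _) = root
lca-⊑ˡ (inʳ _) root    = root
lca-⊑ˡ (inʳ _) (inˡ _) = root

lca-⊑ʳ : ∀ {t} (N M : Node t) → lca N M ⊑ M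
lca-⊑ʳ (inˡ N) (inˡ M) = inˡ (lca-⊑ʳ N M)
lca-⊑ʳ (inʳ N) (inʳ M) = inʳ (lca-⊑ʳ N M)
lca-⊑ʳ root    _       = root
lca-⊑ʳ (inˡ _) root    = root
lca-⊑ʳ (inˡ _) (inʳ _) = root
lca-⊑ʳ (inʳ _) root    = root
lca-⊑ʳ (inʳ _) (inˡ _) = root

lca-lowest : ∀ {t} {A N M : Node t} → A ⊑ N → A ⊑ M → A ⊑ lca N M
lca-lowest root    _       = root
lca-lowest (inˡ p) (inˡ q) = inˡ (lca-lowest p q)
lca-lowest (inʳ p) (inʳ q) = inʳ (lca-lowest p q)

module _ {c ℓ₁ ℓ₂} (F : OrderedField c ℓ₁ ℓ₂) where

  open OrderedField F

  -- weight-sym also makes the weight depend only on the endpoints of an edge.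
  record RoadNetwork : Set (lsuc 0ℓ ⊔ c ⊔ ℓ₁ ⊔ ℓ₂) where
    field
      order      : ℕ
    V : Set
    V = Fin order
    field
      Edge       : Rel V 0ℓ
      edge?      : Decidable Edge
      edge-sym   : Symmetric Edge
      weight     : ∀ {u v} → Edge u v → Carrier
      weight-sym : ∀ {u v} (e : Edge u v) (e′ : Edge v u) → weight e ≈ weight e′
      weight-pos : ∀ {u v} (e : Edge u v) → 0# < weight e

    infixr 5 _∷_
    data Walk : V → V → Set where
      []  : ∀ {v} → Walk v v
      _∷_ : ∀ {u v w} → Edge u v → Walk v w → Walk u w

    walkVertices : ∀ {s t} → Walk s t → List V
    walkVertices {s} []      = s ∷ []
    walkVertices {s} (_ ∷ p) = s ∷ walkVertices p

    walkWeight : ∀ {s t} → Walk s t → Carrier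
    walkWeight []      = 0#
    walkWeight (e ∷ p) = weight e + walkWeight p

    Path : V → V → Set
    Path s t = Σ[ p ∈ Walk s t ] Unique (walkVertices p)

    vertices : ∀ {s t} → Path s t → List V
    vertices (p , _) = walkVertices p

    pathWeight : ∀ {s t} → Path s t → Carrier
    pathWeight (p , _) = walkWeight p

    Shortest : ∀ {s t} → Path s t → Set ℓ₂
    Shortest {s} {t} p = (q : Path s t) → pathWeight p ≤ pathWeight q

    -- The graph of the distance function: d_G(s,t) = δ.
    IsDistance : V → V → Carrier → Set (ℓ₁ ⊔ ℓ₂)
    IsDistance s t δ = Σ[ p ∈ Path s t ] Shortest p × pathWeight p ≈ δ

    -- d_G(s,t) = d_G(s,r) + d_G(r,t).
    DistanceVia : V → V → V → Set (c ⊔ ℓ₁ ⊔ ℓ₂)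
    DistanceVia s r t =
      ∃[ δ₁ ] ∃[ δ₂ ] IsDistance s r δ₁ × IsDistance r t δ₂ × IsDistance s t (δ₁ + δ₂)

  module _ (G : RoadNetwork) where

    open RoadNetwork G

    -- Condition `separates` provides a shortest path between any two vertices,
    -- so a graph with a hierarchy is connected.
    record BalancedTreeHierarchy : Set (c ⊔ ℓ₁ ⊔ ℓ₂) where
      field
        β     : Carrier
        0<β   : 0# < β
        β≤½   : β + β ≤ 1#
        tree  : BinaryTree
        ℓ     : V → Node tree
        ℓ-surjective : Surjective _≡_ _≡_ ℓ

      ∣Left∣ : Node tree → ℕ
      ∣Left∣ N = card (λ v → inLeft? N (ℓ v))

      ∣Right∣ : Node tree → ℕ
      ∣Right∣ N = card (λ v → inRight? N (ℓ v))

      ∣Subtree∣ : Node tree → ℕ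
      ∣Subtree∣ N = card (λ v → N ⊑? ℓ v)

      field
        balancedˡ : ∀ N → Internal N →
          fromℕ (∣Left∣ N) ≤ (1# - β) * fromℕ (∣Subtree∣ N)
        balancedʳ : ∀ N → Internal N →
          fromℕ (∣Right∣ N) ≤ (1# - β) * fromℕ (∣Subtree∣ N)
        separates : ∀ s t → Σ[ p ∈ Path s t ]
          Shortest p × ∃[ r ] ℓ r ≡ lca (ℓ s) (ℓ t) × r ∈ vertices p

      infix 4 _≼_
      _≼_ : Rel V 0ℓ
      u ≼ v = ℓ u ⊑ ℓ v

    -- Each set L(v) is given by a list of its entries; order and repetition
    -- play no role.
    record DistanceLabelling : Set (c ⊔ ℓ₁ ⊔ ℓ₂) where
      field
        entries : V → List (V × Carrier)
        correct : ∀ {v u δ} → (u , δ) ∈ entries v → IsDistance v u δ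

    open DistanceLabelling

    HasEntry : V → DistanceLabelling → V → Set c
    HasEntry u L v = ∃[ δ ] (u , δ) ∈ entries L v

    syntax HasEntry u L v = u ∈[ L ] v

    module _ (H : BalancedTreeHierarchy) where

      open BalancedTreeHierarchy H

      record IsHierarchicalCut2HopLabelling (L : DistanceLabelling)
             : Set (c ⊔ ℓ₁ ⊔ ℓ₂) where
        field
          hierarchical : ∀ v u → u ∈[ L ] v → u ≼ v
          cut2Hop      : ∀ s t → ∃[ r ] ℓ r ≡ lca (ℓ s) (ℓ t) ×
            ∃[ δ₁ ] ∃[ δ₂ ] (r , δ₁) ∈ entries L s × (r , δ₂) ∈ entries L t ×
                            IsDistance s t (δ₁ + δ₂)

      -- The vertex cut of a node N is { u | ℓ u ≡ N }.
      CutCoverProperty : DistanceLabelling → Set (c ⊔ ℓ₁ ⊔ ℓ₂)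
      CutCoverProperty L = ∀ N v u → N ⊑ ℓ v → ℓ v ≢ N → ℓ u ≡ N →
        (u ∈[ L ] v) ⇔ (¬ (∃[ u′ ] ℓ u′ ≡ N × u′ ≢ u × DistanceVia u u′ v))

{-# OPTIONS --safe #-}

-- Apply the 2-hop property of L to the pair u, v: since ℓ u is an ancestor of
-- ℓ v, the hop r lies in the cut of u.  If r ≠ u, then r is a cut vertex on a
-- shortest path from u to v, which the cut cover property of L* excludes; so
-- r = u, and L(v) has an entry for u.  Labels record distances from v, whereas
-- the cut cover property uses distances to v, so IsDistance has to be symmetric.
module Submission where

open import Defs
open import Data.Fin.Properties using (_≟_)
open import Data.List using (_∷_)
open import Data.List.Relation.Binary.Permutation.Propositional
  using (_↭_; ↭-refl; ↭-sym; ↭-trans; prep; swap; ↭⇒↭ₛ)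
open import Data.List.Relation.Binary.Permutation.Setoid.Properties
  using (Unique-resp-↭)
open import Data.Product using (_,_; proj₁)
open import Function.Bundles using (_⇔_; mk⇔; module Equivalence)
open import Relation.Binary using (module IsTotalOrder)
open import Relation.Binary.PropositionalEquality
  using (_≡_; _≢_; refl; sym; trans; cong; setoid)
import Relation.Binary.Reasoning.Setoid as ≈-Reasoning
open import Relation.Nullary using (yes; no; contradiction)

⊑⇒lca≡ : ∀ {t} {N M : Node t} → N ⊑ M → lca N M ≡ N
⊑⇒lca≡ root    = refl
⊑⇒lca≡ (inˡ p) = cong inˡ (⊑⇒lca≡ p)
⊑⇒lca≡ (inʳ p) = cong inʳ (⊑⇒lca≡ p)

module _ {c ℓ₁ ℓ₂} {F : OrderedField c ℓ₁ ℓ₂} (G : RoadNetwork F) where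

  open OrderedField F
    using (_≈_; _+_; +-comm; +-congˡ; +-cong; +-assoc; isTotalOrder)
    renaming (setoid to ≈-setoid; refl to ≈-refl; sym to ≈-sym; trans to ≈-trans)
  open IsTotalOrder isTotalOrder using (≤-respˡ-≈; ≤-respʳ-≈)
  open RoadNetwork G

  snoc : ∀ {s t u} → Walk s t → Edge t u → Walk s u
  snoc []      e = e ∷ []
  snoc (d ∷ p) e = d ∷ snoc p e

  reverse : ∀ {s t} → Walk s t → Walk t s
  reverse []      = []
  reverse (e ∷ p) = snoc (reverse p) (edge-sym e)

  -- Stated up to permutation: reversal only has to preserve distinctness of the vertices, which
  -- does not depend on their order.
  walkVertices-snoc : ∀ {s t u} (p : Walk s t) (e : Edge t u) →
    walkVertices (snoc p e) ↭ u ∷ walkVertices p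
  walkVertices-snoc []      e = swap _ _ ↭-refl
  walkVertices-snoc (d ∷ p) e =
    ↭-trans (prep _ (walkVertices-snoc p e)) (swap _ _ ↭-refl)

  walkVertices-reverse : ∀ {s t} (p : Walk s t) →
    walkVertices (reverse p) ↭ walkVertices p
  walkVertices-reverse []      = ↭-refl
  walkVertices-reverse (e ∷ p) =
    ↭-trans (walkVertices-snoc (reverse p) (edge-sym e))
            (prep _ (walkVertices-reverse p))

  walkWeight-snoc : ∀ {s t u} (p : Walk s t) (e : Edge t u) →
    walkWeight (snoc p e) ≈ walkWeight p + weight e
  walkWeight-snoc []      e = +-comm _ _
  walkWeight-snoc (d ∷ p) e =
    ≈-trans (+-congˡ (walkWeight-snoc p e)) (≈-sym (+-assoc _ _ _))

  walkWeight-reverse : ∀ {s t} (p : Walk s t) →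
    walkWeight (reverse p) ≈ walkWeight p
  walkWeight-reverse []      = ≈-refl
  walkWeight-reverse (e ∷ p) = begin
    walkWeight (snoc (reverse p) (edge-sym e))   ≈⟨ walkWeight-snoc (reverse p) _ ⟩
    -- The reversed edge is a different term of type `Edge`; `weight-sym` identifies the two
    -- weights.
    walkWeight (reverse p) + weight (edge-sym e) ≈⟨ +-cong (walkWeight-reverse p)
                                                           (weight-sym _ e) ⟩
    walkWeight p + weight e                      ≈⟨ +-comm _ _ ⟩
    weight e + walkWeight p                      ∎
    where open ≈-Reasoning ≈-setoid

  reversePath : ∀ {s t} → Path s t → Path t s
  reversePath (p , unique) =
    reverse p ,
    Unique-resp-↭ (setoid V) (↭⇒↭ₛ (↭-sym (walkVertices-reverse p))) unique

  -- Reversal is a weight-preserving map between paths in the two directions, so it carries a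
  -- shortest path to a shortest path: a competitor `q` of the reversed path is itself reversed and
  -- compared with `p`.
  IsDistance-sym : ∀ {s t δ} →
    IsDistance s t δ → IsDistance t s δ
  IsDistance-sym (p , shortest , p≈δ) =
    reversePath p ,
    (λ q → ≤-respˡ-≈ (≈-sym (walkWeight-reverse (proj₁ p)))
             (≤-respʳ-≈ (walkWeight-reverse (proj₁ q)) (shortest (reversePath q)))) ,
    ≈-trans (walkWeight-reverse (proj₁ p)) p≈δ

  module _ {H : BalancedTreeHierarchy F G} where

    open BalancedTreeHierarchy H
    open DistanceLabelling using (correct)
    open IsHierarchicalCut2HopLabelling

    cutCover⇒∈ : ∀ {L* L} →
      IsHierarchicalCut2HopLabelling F G H L* → CutCoverProperty F G H L* →
      IsHierarchicalCut2HopLabelling F G H L →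
      ∀ {u v} → ℓ u ≢ ℓ v → HasEntry F G u L* v → HasEntry F G u L v
    cutCover⇒∈ {L = L} hier* cover hier {u} {v} ℓu≢ℓv u∈L*v
      -- The order relation is read off `L*`, where the entry for `u` is given.
      with u≼v ← hierarchical hier* v u u∈L*v
      with r , ℓr≡lca , δ₁ , δ₂ , r∈Lu , r∈Lv , u-v ← cut2Hop hier u v
      with r ≟ u
    ... | yes refl = δ₂ , r∈Lv
    ... | no r≢u   = contradiction
      (r , trans ℓr≡lca (⊑⇒lca≡ u≼v) , r≢u ,
       δ₁ , δ₂ , correct L r∈Lu , IsDistance-sym (correct L r∈Lv) , u-v)
      -- The cut is the node `ℓ u`; `v` lies strictly below it, as `u ≼ v` and the two nodes differ.
      (Equivalence.to (cover (ℓ u) v u u≼v (λ eq → ℓu≢ℓv (sym eq)) refl) u∈L*v)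

lemma4p17 : ∀ {c ℓ₁ ℓ₂} (F : OrderedField c ℓ₁ ℓ₂) (G : RoadNetwork F)
    (H : BalancedTreeHierarchy F G) (L* : DistanceLabelling F G) →
    IsHierarchicalCut2HopLabelling F G H L* →
    CutCoverProperty F G H L* →
    ∀ u v → BalancedTreeHierarchy.ℓ H u ≢ BalancedTreeHierarchy.ℓ H v →
    HasEntry F G u L* v ⇔
    (∀ L → IsHierarchicalCut2HopLabelling F G H L → HasEntry F G u L v)
lemma4p17 F G H L* hier* cover u v ℓu≢ℓv = mk⇔
  (λ u∈L*v L hier → cutCover⇒∈ G hier* cover hier ℓu≢ℓv u∈L*v)
  -- `L*` is itself one of the labellings being intersected.
  (λ u∈Lv → u∈Lv L* hier*)
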